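{- Let $\alpha\in\mathbb{N}$, let $m$ be a positive odd integer with $m>4\alpha+2$, and let $\mathbb{S}=\langle 4,4\alpha+2,m\rangle$, with Betti elements $\beta_1=\beta_2=8\alpha+4$ and $\beta_3=2m$. Then the factorizations of $\beta_1=\beta_2$ (with respect to $(4,4\alpha+2,m)$) are exactly $(2\alpha+1,0,0)$ and $(0,2,0)$, and the factorizations of $\beta_3$ are exactly $(0,0,2)$ and the tuples $\left(\frac{m-k(2\alpha+1)}{2},k,0\right)$ where $k$ ranges over positive odd integers with $k\le\frac{m}{2\alpha+1}$.
   Context: $\mathbb{N}=\{0,1,2,\dots\}$. For a numerical semigroup $\mathbb{S}=\langle a_1,a_2,a_3\rangle$ (the set of $\mathbb{N}$-linear combinations of $a_1,a_2,a_3$) and $a\in\mathbb{S}$, a factorization of $a$ is a tuple $(\eta_1,\eta_2,\eta_3)\in\mathbb{N}^3$ with $\eta_1a_1+\eta_2a_2+\eta_3a_3=a$. -}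

module Defs where

open import Data.Nat using (ℕ; _+_; _*_; _∸_; _/_; _%_; _≤_; _<_)
open import Data.Product using (_×_; _,_; ∃-syntax)
open import Level using (0ℓ)
open import Relation.Binary.PropositionalEquality using (_≡_)
open import Relation.Unary using (Pred)

ℕ³ : Set
ℕ³ = ℕ × ℕ × ℕ

Odd : Pred ℕ 0ℓ
Odd n = n % 2 ≡ 1

-- The factorizations of a with respect to the generators (a₁ , a₂ , a₃).
-- This set is nonempty exactly when a lies in the semigroup ⟨a₁ , a₂ , a₃⟩,
-- so membership is not assumed separately.
Factorizations : ℕ³ → ℕ → Pred ℕ³ 0ℓ
Factorizations (a₁ , a₂ , a₃) a (η₁ , η₂ , η₃) =
  η₁ * a₁ + η₂ * a₂ + η₃ * a₃ ≡ a

-- Both uses of truncated arithmetic below agree with the rational ones when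
-- m is odd: for natural k, k ≤ ⌊m / (2α+1)⌋ iff k ≤ m / (2α+1), and then
-- m − k(2α+1) is nonnegative and, k being odd, even.
-- The summands are ordered as 1 + 2 * α so that the divisor is visibly nonzero.
OddFamily : ℕ → ℕ → Pred ℕ³ 0ℓ
OddFamily α m η =
  ∃[ k ] 0 < k × Odd k × k ≤ m / (1 + 2 * α)
       × η ≡ ((m ∸ k * (1 + 2 * α)) / 2 , k , 0)

{-# OPTIONS --safe #-}
module Submission where

-- If m is odd and x ≤ m, then c m + 2 t = 2 x forces c = 0 or (c , t) = (2 , 0).
-- Write a factorization as c m + 2 (b n + 2 a) with n = 2 α + 1.  For β₁ = 4 n this
-- gives c = 0, and b n + 2 a = 2 n has the same shape with the odd number n
-- in place of m.  For β₃ = 2 m it leaves c = 2, or b n + 2 a = m with b odd.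

open import Data.Nat using (ℕ; suc; _+_; _*_; _∸_; _/_; _%_; _≤_; _<_; z<s)
open import Data.Nat.Divisibility using (_∣_; divides; ∣m+n∣m⇒∣n)
open import Data.Nat.DivMod
  using (m≡m%n+[m/n]*n; [m+kn]%n≡m%n; m*n%n≡0; m*n/n≡m; m/n*n≡m; m/n*n≤m; /-monoˡ-≤)
open import Data.Nat.Properties
open import Data.Nat.Tactic.RingSolver using (solve-∀)
open import Data.Product using (_×_; _,_)
open import Data.Sum using (_⊎_; inj₁; inj₂)
open import Function.Bundles using (_⇔_; mk⇔)
open import Relation.Nullary using (¬_; contradiction)
open import Relation.Binary.PropositionalEquality
  using (_≡_; refl; sym; trans; cong; subst; module ≡-Reasoning)
open import Defs

odd-+-double : ∀ k s → (k + s * 2) % 2 ≡ k % 2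
odd-+-double k s = [m+kn]%n≡m%n k s 2

odd⇒≢double : ∀ {m} s → Odd m → ¬ m ≡ s * 2
odd⇒≢double s odd-m refl with trans (sym odd-m) (m*n%n≡0 s 2)
... | ()

odd⇒positive : ∀ {m} → Odd m → 0 < m
odd⇒positive {suc _} _ = z<s

1+2*-odd : ∀ α → Odd (1 + 2 * α)
1+2*-odd α = trans (cong (λ x → (1 + x) % 2) (*-comm 2 α)) (odd-+-double 1 α)

-- Parity rules out `c = 1`, since `m + 2 * t` is odd. Once `c` is at least 2, two copies of `m`
-- already exhaust `2 * x ≤ 2 * m`, so everything beyond them vanishes and the bound is attained.
odd-coefficient-of-double : ∀ {m} x c t → Odd m → x ≤ m → c * m + 2 * t ≡ 2 * x →
  (c ≡ 0 × t ≡ x) ⊎ (c ≡ 2 × t ≡ 0 × x ≡ m)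
odd-coefficient-of-double x 0 t odd-m x≤m eq = inj₁ (refl , *-cancelˡ-≡ t x 2 eq)
odd-coefficient-of-double {m} x 1 t odd-m x≤m eq =
  contradiction shifted (odd⇒≢double x (trans (odd-+-double m t) odd-m))
  where
  shifted : m + t * 2 ≡ x * 2
  shifted = begin
    m + t * 2      ≡⟨ lemma m t ⟩
    1 * m + 2 * t  ≡⟨ eq ⟩
    2 * x          ≡⟨ *-comm 2 x ⟩
    x * 2          ∎
    where
    open ≡-Reasoning
    lemma : ∀ m t → m + t * 2 ≡ 1 * m + 2 * t
    lemma = solve-∀
odd-coefficient-of-double {m} x (suc (suc c)) t odd-m x≤m eq =
  inj₂ (cong (λ i → suc (suc i)) c≡0 , t≡0 , x≡m)
  where
  regroup : ∀ c m t → 2 * m + (c * m + 2 * t) ≡ suc (suc c) * m + 2 * t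
  regroup = solve-∀
  split : 2 * m + (c * m + 2 * t) ≡ 2 * x
  split = trans (regroup c m t) eq
  rest≡0 : c * m + 2 * t ≡ 0
  rest≡0 = n≤0⇒n≡0 (+-cancelˡ-≤ (2 * m) _ 0 (begin
    2 * m + (c * m + 2 * t)  ≡⟨ split ⟩
    2 * x                    ≤⟨ *-monoʳ-≤ 2 x≤m ⟩
    2 * m                    ≡⟨ +-identityʳ _ ⟨
    2 * m + 0                ∎))
    where open ≤-Reasoning
  c≡0 : c ≡ 0
  c≡0 with m*n≡0⇒m≡0∨n≡0 c (m+n≡0⇒m≡0 (c * m) rest≡0)
  ... | inj₁ p = p
  ... | inj₂ m≡0 = contradiction m≡0 (m<n⇒n≢0 (odd⇒positive odd-m))
  t≡0 : t ≡ 0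
  t≡0 = *-cancelˡ-≡ t 0 2 (m+n≡0⇒n≡0 (c * m) rest≡0)
  x≡m : x ≡ m
  x≡m = *-cancelˡ-≡ x m 2
    (trans (sym split) (trans (cong (2 * m +_) rest≡0) (+-identityʳ _)))

-- Isolates the only odd generator: the other two are twice `2` and twice `1 + 2 * α`, which gives
-- the shape that `odd-coefficient-of-double` expects.
regroup-factorization : ∀ α m a b c →
  c * m + 2 * (b * (1 + 2 * α) + 2 * a) ≡ a * 4 + b * (4 * α + 2) + c * m
regroup-factorization = solve-∀

theorem5 : (α m : ℕ) → 0 < m → Odd m → 4 * α + 2 < m →
    let gens = (4 , 4 * α + 2 , m)
        β₁ = 8 * α + 4
        β₃ = 2 * m
    in ((η : ℕ³) → Factorizations gens β₁ η ⇔ (η ≡ (2 * α + 1 , 0 , 0) ⊎ η ≡ (0 , 2 , 0)))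
     × ((η : ℕ³) → Factorizations gens β₃ η ⇔ (η ≡ (0 , 0 , 2) ⊎ OddFamily α m η))
theorem5 α m 0<m odd-m 4α+2<m =
  (λ η → mk⇔ (β₁-to η) (β₁-from η)) , (λ η → mk⇔ (β₃-to η) (β₃-from η))
  where
  gens : ℕ³
  gens = 4 , 4 * α + 2 , m

  n : ℕ
  n = 1 + 2 * α

  -- The bound needed to apply `odd-coefficient-of-double` with `x = 2 * n`, half of β₁.
  2n≤m : 2 * n ≤ m
  2n≤m = ≤-trans (≤-reflexive (identity α)) (<⇒≤ 4α+2<m)
    where
    identity : ∀ α → 2 * (1 + 2 * α) ≡ 4 * α + 2
    identity = solve-∀

  β₁-to : ∀ η → Factorizations gens (8 * α + 4) η →
    η ≡ (2 * α + 1 , 0 , 0) ⊎ η ≡ (0 , 2 , 0)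
  β₁-to (a , b , c) eq
    with odd-coefficient-of-double (2 * n) c (b * n + 2 * a) odd-m 2n≤m
           (trans (regroup-factorization α m a b c) (trans eq (identity α)))
    where
    identity : ∀ α → 8 * α + 4 ≡ 2 * (2 * (1 + 2 * α))
    identity = solve-∀
  -- Two copies of `m` would force `m = 2 * n`, which is even.
  ... | inj₂ (_ , _ , 2n≡m) =
        contradiction (trans (sym 2n≡m) (*-comm 2 n)) (odd⇒≢double n odd-m)
  -- Now `b * n + 2 * a ≡ 2 * n`. The bound is an equality here, so both alternatives occur and give
  -- the two factorizations.
  ... | inj₁ (refl , rest) with odd-coefficient-of-double n b a (1+2*-odd α) ≤-refl rest
  ...   | inj₁ (refl , refl) = inj₁ (cong (_, 0 , 0) (+-comm 1 (2 * α)))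
  ...   | inj₂ (refl , refl , _) = inj₂ refl

  β₁-from : ∀ η → η ≡ (2 * α + 1 , 0 , 0) ⊎ η ≡ (0 , 2 , 0) →
    Factorizations gens (8 * α + 4) η
  β₁-from _ (inj₁ refl) = identity α
    where
    identity : ∀ α → (2 * α + 1) * 4 + 0 + 0 ≡ 8 * α + 4
    identity = solve-∀
  β₁-from _ (inj₂ refl) = identity α
    where
    identity : ∀ α → 2 * (4 * α + 2) + 0 ≡ 8 * α + 4
    identity = solve-∀

  β₃-to : ∀ η → Factorizations gens (2 * m) η → η ≡ (0 , 0 , 2) ⊎ OddFamily α m η
  β₃-to (a , b , c) eq
    with odd-coefficient-of-double m c (b * n + 2 * a) odd-m ≤-refl
           (trans (regroup-factorization α m a b c) eq)
  -- The alternative `n ≡ 0` has no clause because `n` is a successor.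
  ... | inj₂ (refl , rest , _) with m*n≡0⇒m≡0∨n≡0 b (m+n≡0⇒m≡0 (b * n) rest)
  ...   | inj₁ refl = inj₁ (cong (_, 0 , 2) (*-cancelˡ-≡ a 0 2 rest))
  -- Here `b * n + 2 * a ≡ m`. As `n` is odd, `b` has the parity of `m`; solving for `a` gives the
  -- first coordinate.
  β₃-to (a , b , c) eq | inj₁ (refl , rest) =
    inj₂ (b , odd⇒positive odd-b , odd-b , b≤m/n , cong (_, b , 0) a≡)
    where
    open ≡-Reasoning
    identity : ∀ α a b → b + (b * α + a) * 2 ≡ b * (1 + 2 * α) + 2 * a
    identity = solve-∀
    odd-b : Odd b
    odd-b = begin
      b % 2                          ≡⟨ odd-+-double b (b * α + a) ⟨
      (b + (b * α + a) * 2) % 2      ≡⟨ cong (_% 2) (trans (identity α a b) rest) ⟩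
      m % 2                          ≡⟨ odd-m ⟩
      1                              ∎
    b≤m/n : b ≤ m / n
    b≤m/n = subst (_≤ m / n) (m*n/n≡m b n)
      (/-monoˡ-≤ n (subst (b * n ≤_) rest (m≤m+n (b * n) (2 * a))))
    a≡ : a ≡ (m ∸ b * n) / 2
    a≡ = begin
      a                               ≡⟨ m*n/n≡m a 2 ⟨
      a * 2 / 2                       ≡⟨ cong (_/ 2) (*-comm a 2) ⟩
      2 * a / 2                       ≡⟨ cong (_/ 2) (m+n∸m≡n (b * n) (2 * a)) ⟨
      (b * n + 2 * a ∸ b * n) / 2     ≡⟨ cong (λ x → (x ∸ b * n) / 2) rest ⟩
      (m ∸ b * n) / 2                 ∎

  β₃-from : ∀ η → η ≡ (0 , 0 , 2) ⊎ OddFamily α m η → Factorizations gens (2 * m) η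
  β₃-from _ (inj₁ refl) = refl
  β₃-from _ (inj₂ (k , _ , odd-k , k≤m/n , refl)) = begin
    h * 4 + k * (4 * α + 2) + 0  ≡⟨ regroup-factorization α m h k 0 ⟨
    2 * (k * n + 2 * h)          ≡⟨ cong (λ x → 2 * (k * n + x)) (trans (*-comm 2 h) (m/n*n≡m 2∣d)) ⟩
    2 * (k * n + d)              ≡⟨ cong (2 *_) (m+[n∸m]≡n kn≤m) ⟩
    2 * m                        ∎
    where
    open ≡-Reasoning
    d h : ℕ
    d = m ∸ k * n
    h = d / 2
    -- This makes the truncated subtraction in `d` exact.
    kn≤m : k * n ≤ m
    kn≤m = ≤-trans (*-monoˡ-≤ n k≤m/n) (m/n*n≤m m n)
    odd-form : ∀ {x} → Odd x → x ≡ 1 + x / 2 * 2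
    odd-form {x} odd-x = trans (m≡m%n+[m/n]*n x 2) (cong (_+ x / 2 * 2) odd-x)
    identity : ∀ d q s → 1 + ((q + s) * 2 + d) ≡ s * 2 + (1 + q * 2) + d
    identity = solve-∀
    expand : ∀ k α → k * α * 2 + k ≡ k * (1 + 2 * α)
    expand = solve-∀
    -- Both `k * n` and `m` are odd. Cancelling 1 on each side of `k * n + d ≡ m` leaves an even
    -- number plus `d` equal to an even number.
    2∣d : 2 ∣ d
    2∣d = ∣m+n∣m⇒∣n (divides (m / 2) (suc-injective (begin
      1 + ((k / 2 + k * α) * 2 + d)          ≡⟨ identity d (k / 2) (k * α) ⟩
      k * α * 2 + (1 + k / 2 * 2) + d        ≡⟨ cong (λ x → k * α * 2 + x + d) (odd-form odd-k) ⟨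
      k * α * 2 + k + d                      ≡⟨ cong (_+ d) (expand k α) ⟩
      k * n + d                              ≡⟨ m+[n∸m]≡n kn≤m ⟩
      m                                      ≡⟨ odd-form odd-m ⟩
      1 + m / 2 * 2                          ∎))) (divides (k / 2 + k * α) refl)
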